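{- Let $\alpha\in[0,1]$, let $G$ be a simple undirected graph on $n$ vertices, and let $\lambda\in\mathbb{R}$. Let $x\in\mathbb{R}^n$ be such that $\sum_{i}x_i=0$ and $x_v=0$ for some $v\in V(G)$, and let $N_v$ be the set of edges of $G$ that contain the vertex $v$. If $v$ is adjacent to every vertex $u\in V(G)$ such that $x_u\neq 0$, then $B(G)x=\lambda x$ if and only if $B(G-N_v)x=(\lambda-1+\alpha)x$.
   Context: For a graph $G$ on $n$ vertices, $A(G)$ is the adjacency matrix, $D(G)$ the diagonal degree matrix, $L(G)=D(G)-A(G)$ the Laplacian, and $B(G)=B_\alpha(G)=\alpha A(G)+(1-\alpha)L(G)$. $G-N_v$ denotes the graph on the same vertex set $V(G)$ obtained by deleting the edges in $N_v$ (the vertex $v$ is kept). -}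

module Defs where

open import Algebra.Bundles.Raw using (RawRing)
import Algebra.Definitions.RawMonoid as RawMonoidDefs
open import Data.Bool.Base using (if_then_else_)
open import Data.Fin.Base using (Fin)
import Data.Fin.Properties as Fin
open import Data.Nat.Base as ℕ using (ℕ)
import Data.Nat.Properties as ℕ
open import Data.Product using (∃; _,_; proj₁; proj₂; _×_)
open import Data.Rational.Base as ℚ using (ℚ; 0ℚ; 1ℚ; ½; Positive)
import Data.Rational.Properties as ℚ
open import Data.Rational.Solver using (module +-*-Solver)
open import Data.Sum.Base using (_⊎_; swap)
import Data.Vec.Base as Vec
open import Data.Vec.Functional using (Vector)
open import Data.Vec.Functional.Relation.Binary.Pointwise using (Pointwise)
open import Level using (0ℓ)
open import Relation.Binary.Core using (Rel; _⇒_)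
open import Relation.Binary.Definitions using (Decidable; Irreflexive; Symmetric)
open import Relation.Binary.PropositionalEquality
open import Relation.Nullary using (¬_; does)
open import Relation.Nullary.Decidable using (_×-dec_; _⊎-dec_; ¬?)

-- The real numbers as Cauchy sequences of rationals, with equality as a
-- setoid relation.  A real carries its modulus of convergence (∃ is Σ), so
-- decidability of the order on ℚ makes _≈_ stable under double negation.

IsCauchy : (ℕ → ℚ) → Set
IsCauchy f = ∀ ε → .{{Positive ε}} →
  ∃ λ N → ∀ m n → N ℕ.≤ m → N ℕ.≤ n → ℚ.∣ f m ℚ.- f n ∣ ℚ.≤ ε

record ℝ : Set where
  constructor mkℝ
  field
    seq    : ℕ → ℚ
    cauchy : IsCauchy seq

open ℝ public

infix 4 _≈_ _≤_

_≈_ : Rel ℝ 0ℓ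
x ≈ y = ∀ ε → .{{Positive ε}} →
  ∃ λ N → ∀ n → N ℕ.≤ n → ℚ.∣ seq x n ℚ.- seq y n ∣ ℚ.≤ ε

_≤_ : Rel ℝ 0ℓ
x ≤ y = ∀ ε → .{{Positive ε}} →
  ∃ λ N → ∀ n → N ℕ.≤ n → seq x n ℚ.≤ seq y n ℚ.+ ε

private
  abstract
    half-pos : ∀ ε → .{{Positive ε}} → Positive (½ ℚ.* ε)
    half-pos ε = ℚ.pos*pos⇒pos ½ ε

    halves : ∀ ε → ½ ℚ.* ε ℚ.+ ½ ℚ.* ε ≡ ε
    halves ε = trans (sym (ℚ.*-distribʳ-+ ε ½ ½)) (ℚ.*-identityˡ ε)

    const-cauchy : ∀ q → IsCauchy (λ _ → q)
    const-cauchy q ε = 0 , λ _ _ _ _ →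
      subst (λ d → ℚ.∣ d ∣ ℚ.≤ ε) (sym (ℚ.+-inverseʳ q)) (ℚ.<⇒≤ (ℚ.positive⁻¹ ε))

    neg-cauchy : ∀ {f} → IsCauchy f → IsCauchy (λ n → ℚ.- f n)
    neg-cauchy {f} cf ε = proj₁ (cf ε) , λ m n N≤m N≤n →
      subst (ℚ._≤ ε)
        (trans (sym (ℚ.∣-p∣≡∣p∣ (f m ℚ.- f n)))
               (cong ℚ.∣_∣ (ℚ.neg-distrib-+ (f m) (ℚ.- f n))))
        (proj₂ (cf ε) m n N≤m N≤n)

    ∣[a+b]-[c+d]∣-bound : ∀ {δ} → ∀ a b c d →
      ℚ.∣ a ℚ.- c ∣ ℚ.≤ δ → ℚ.∣ b ℚ.- d ∣ ℚ.≤ δ →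
      ℚ.∣ (a ℚ.+ b) ℚ.- (c ℚ.+ d) ∣ ℚ.≤ δ ℚ.+ δ
    ∣[a+b]-[c+d]∣-bound {δ} a b c d a-c≤δ b-d≤δ = begin
      ℚ.∣ (a ℚ.+ b) ℚ.- (c ℚ.+ d) ∣
        ≡⟨ cong ℚ.∣_∣ (rearrange a b c d) ⟩
      ℚ.∣ (a ℚ.- c) ℚ.+ (b ℚ.- d) ∣
        ≤⟨ ℚ.∣p+q∣≤∣p∣+∣q∣ (a ℚ.- c) (b ℚ.- d) ⟩
      ℚ.∣ a ℚ.- c ∣ ℚ.+ ℚ.∣ b ℚ.- d ∣
        ≤⟨ ℚ.+-mono-≤ a-c≤δ b-d≤δ ⟩
      δ ℚ.+ δ ∎
      where
      open ℚ.≤-Reasoning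
      rearrange : ∀ a b c d →
        (a ℚ.+ b) ℚ.- (c ℚ.+ d) ≡ (a ℚ.- c) ℚ.+ (b ℚ.- d)
      rearrange = solve 4 (λ a b c d →
        (a :+ b) :- (c :+ d) := (a :- c) :+ (b :- d)) refl
        where open +-*-Solver

    +-cauchy : ∀ {f g} → IsCauchy f → IsCauchy g → IsCauchy (λ n → f n ℚ.+ g n)
    +-cauchy {f} {g} cf cg ε =
      let F , f-f≤ε/2 = cf (½ ℚ.* ε) {{half-pos ε}}
          G , g-g≤ε/2 = cg (½ ℚ.* ε) {{half-pos ε}}
      in F ℕ.⊔ G , λ m n N≤m N≤n → ℚ.≤-trans
        (∣[a+b]-[c+d]∣-bound (f m) (g m) (f n) (g n)
          (f-f≤ε/2 m n (ℕ.m⊔n≤o⇒m≤o F G N≤m) (ℕ.m⊔n≤o⇒m≤o F G N≤n))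
          (g-g≤ε/2 m n (ℕ.m⊔n≤o⇒n≤o F G N≤m) (ℕ.m⊔n≤o⇒n≤o F G N≤n)))
        (ℚ.≤-reflexive (halves ε))

eventuallyBounded : ∀ {f} → IsCauchy f →
  ∃ λ K → Positive K × ∃ λ N → ∀ n → N ℕ.≤ n → ℚ.∣ f n ∣ ℚ.≤ K
eventuallyBounded {f} cf =
  1ℚ ℚ.+ ℚ.∣ f N ∣ ,
  ℚ.positive (ℚ.+-mono-<-≤ (ℚ.positive⁻¹ 1ℚ) (ℚ.0≤∣p∣ (f N))) ,
  N , λ n N≤n → begin
    ℚ.∣ f n ∣
      ≡⟨ cong ℚ.∣_∣ (rearrange (f n) (f N)) ⟩
    ℚ.∣ (f n ℚ.- f N) ℚ.+ f N ∣
      ≤⟨ ℚ.∣p+q∣≤∣p∣+∣q∣ (f n ℚ.- f N) (f N) ⟩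
    ℚ.∣ f n ℚ.- f N ∣ ℚ.+ ℚ.∣ f N ∣
      ≤⟨ ℚ.+-monoˡ-≤ ℚ.∣ f N ∣ (proj₂ (cf 1ℚ) n N N≤n ℕ.≤-refl) ⟩
    1ℚ ℚ.+ ℚ.∣ f N ∣ ∎
  where
  open ℚ.≤-Reasoning
  N = proj₁ (cf 1ℚ)
  rearrange : ∀ a b → a ≡ (a ℚ.- b) ℚ.+ b
  rearrange = solve 2 (λ a b → a := (a :- b) :+ b) refl
    where open +-*-Solver

private
  abstract
    scale : ∀ K L → Positive K → Positive L → ∀ ε → Positive ε →
      ∃ λ δ → Positive δ × K ℚ.* δ ℚ.+ L ℚ.* δ ≡ ε
    scale K L K>0 L>0 ε ε>0 = M⁻¹ ℚ.* ε ,
      ℚ.pos*pos⇒pos M⁻¹ {{ℚ.1/pos⇒pos M {{M>0}}}} ε {{ε>0}} , (begin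
        K ℚ.* (M⁻¹ ℚ.* ε) ℚ.+ L ℚ.* (M⁻¹ ℚ.* ε)
          ≡⟨ ℚ.*-distribʳ-+ (M⁻¹ ℚ.* ε) K L ⟨
        M ℚ.* (M⁻¹ ℚ.* ε)
          ≡⟨ ℚ.*-assoc M M⁻¹ ε ⟨
        (M ℚ.* M⁻¹) ℚ.* ε
          ≡⟨ cong (ℚ._* ε) (ℚ.*-inverseʳ M {{M≢0}}) ⟩
        1ℚ ℚ.* ε
          ≡⟨ ℚ.*-identityˡ ε ⟩
        ε ∎)
      where
      open ≡-Reasoning
      M : ℚ
      M = K ℚ.+ L
      M>0 : Positive M
      M>0 = ℚ.pos+pos⇒pos K {{K>0}} L {{L>0}}
      M≢0 : ℚ.NonZero M
      M≢0 = ℚ.pos⇒nonZero M {{M>0}}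
      M⁻¹ : ℚ
      M⁻¹ = (ℚ.1/ M) {{M≢0}}

    ∣p*q∣-bound : ∀ {C δ} → Positive C → ∀ p q →
      ℚ.∣ p ∣ ℚ.≤ C → ℚ.∣ q ∣ ℚ.≤ δ → ℚ.∣ p ℚ.* q ∣ ℚ.≤ C ℚ.* δ
    ∣p*q∣-bound {C} {δ} C>0 p q p≤C q≤δ = begin
      ℚ.∣ p ℚ.* q ∣
        ≡⟨ ℚ.∣p*q∣≡∣p∣*∣q∣ p q ⟩
      ℚ.∣ p ∣ ℚ.* ℚ.∣ q ∣
        ≤⟨ ℚ.*-monoʳ-≤-nonNeg ℚ.∣ q ∣ {{ℚ.∣-∣-nonNeg q}} p≤C ⟩
      C ℚ.* ℚ.∣ q ∣
        ≤⟨ ℚ.*-monoˡ-≤-nonNeg C {{ℚ.pos⇒nonNeg C {{C>0}}}} q≤δ ⟩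
      C ℚ.* δ ∎
      where open ℚ.≤-Reasoning

    ∣ab-cd∣-bound : ∀ {K L δ} → Positive K → Positive L → ∀ a b c d →
      ℚ.∣ a ∣ ℚ.≤ K → ℚ.∣ d ∣ ℚ.≤ L →
      ℚ.∣ a ℚ.- c ∣ ℚ.≤ δ → ℚ.∣ b ℚ.- d ∣ ℚ.≤ δ →
      ℚ.∣ a ℚ.* b ℚ.- c ℚ.* d ∣ ℚ.≤ K ℚ.* δ ℚ.+ L ℚ.* δ
    ∣ab-cd∣-bound {K} {L} {δ} K>0 L>0 a b c d a≤K d≤L a-c≤δ b-d≤δ = begin
      ℚ.∣ a ℚ.* b ℚ.- c ℚ.* d ∣
        ≡⟨ cong ℚ.∣_∣ (rearrange a b c d) ⟩
      ℚ.∣ a ℚ.* (b ℚ.- d) ℚ.+ d ℚ.* (a ℚ.- c) ∣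
        ≤⟨ ℚ.∣p+q∣≤∣p∣+∣q∣ (a ℚ.* (b ℚ.- d)) (d ℚ.* (a ℚ.- c)) ⟩
      ℚ.∣ a ℚ.* (b ℚ.- d) ∣ ℚ.+ ℚ.∣ d ℚ.* (a ℚ.- c) ∣
        ≤⟨ ℚ.+-mono-≤ (∣p*q∣-bound K>0 a (b ℚ.- d) a≤K b-d≤δ)
                      (∣p*q∣-bound L>0 d (a ℚ.- c) d≤L a-c≤δ) ⟩
      K ℚ.* δ ℚ.+ L ℚ.* δ ∎
      where
      open ℚ.≤-Reasoning
      rearrange : ∀ a b c d →
        a ℚ.* b ℚ.- c ℚ.* d ≡ a ℚ.* (b ℚ.- d) ℚ.+ d ℚ.* (a ℚ.- c)
      rearrange = solve 4 (λ a b c d →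
        a :* b :- c :* d := a :* (b :- d) :+ d :* (a :- c)) refl
        where open +-*-Solver

    *-cauchy : ∀ {f g} → IsCauchy f → IsCauchy g → IsCauchy (λ n → f n ℚ.* g n)
    *-cauchy {f} {g} cf cg ε =
      let K , K>0 , Nf , f≤K = eventuallyBounded cf
          L , L>0 , Ng , g≤L = eventuallyBounded cg
          δ , δ>0 , Kδ+Lδ≡ε  = scale K L K>0 L>0 ε (ℚ.positive (ℚ.positive⁻¹ ε))
          F , f-f≤δ          = cf δ {{δ>0}}
          G , g-g≤δ          = cg δ {{δ>0}}
          N₁ = Nf ℕ.⊔ Ng
          N₂ = F ℕ.⊔ G
      in N₁ ℕ.⊔ N₂ , λ m n N≤m N≤n →
        let m≥N₁ = ℕ.m⊔n≤o⇒m≤o N₁ N₂ N≤m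
            n≥N₁ = ℕ.m⊔n≤o⇒m≤o N₁ N₂ N≤n
            m≥N₂ = ℕ.m⊔n≤o⇒n≤o N₁ N₂ N≤m
            n≥N₂ = ℕ.m⊔n≤o⇒n≤o N₁ N₂ N≤n
        in ℚ.≤-trans
          (∣ab-cd∣-bound K>0 L>0 (f m) (g m) (f n) (g n)
            (f≤K m (ℕ.m⊔n≤o⇒m≤o Nf Ng m≥N₁))
            (g≤L n (ℕ.m⊔n≤o⇒n≤o Nf Ng n≥N₁))
            (f-f≤δ m n (ℕ.m⊔n≤o⇒m≤o F G m≥N₂) (ℕ.m⊔n≤o⇒m≤o F G n≥N₂))
            (g-g≤δ m n (ℕ.m⊔n≤o⇒n≤o F G m≥N₂) (ℕ.m⊔n≤o⇒n≤o F G n≥N₂)))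
          (ℚ.≤-reflexive Kδ+Lδ≡ε)

infixl 6 _+_ _-_
infixl 7 _*_
infix  8 -_

fromℚ : ℚ → ℝ
fromℚ q = mkℝ (λ _ → q) (const-cauchy q)

0ℝ 1ℝ : ℝ
0ℝ = fromℚ 0ℚ
1ℝ = fromℚ 1ℚ

_+_ _*_ : ℝ → ℝ → ℝ
mkℝ f cf + mkℝ g cg = mkℝ (λ n → f n ℚ.+ g n) (+-cauchy {f} {g} cf cg)
mkℝ f cf * mkℝ g cg = mkℝ (λ n → f n ℚ.* g n) (*-cauchy {f} {g} cf cg)

-_ : ℝ → ℝ
- mkℝ f cf = mkℝ (λ n → ℚ.- f n) (neg-cauchy {f} cf)

_-_ : ℝ → ℝ → ℝ
x - y = x + (- y)

ℝ-rawRing : RawRing 0ℓ 0ℓ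
ℝ-rawRing = record
  { Carrier = ℝ ; _≈_ = _≈_ ; _+_ = _+_ ; _*_ = _*_ ; -_ = -_ ; 0# = 0ℝ ; 1# = 1ℝ }

open RawMonoidDefs (RawRing.+-rawMonoid ℝ-rawRing) public
  using (sum) renaming (_×_ to _×ℝ_)

Matrix : ℕ → Set
Matrix n = Vector (Vector ℝ n) n

infix  4 _≋_
infixr 7 _*ᵥ_ _·_

_≋_ : ∀ {n} → Rel (Vector ℝ n) 0ℓ
_≋_ = Pointwise _≈_

_*ᵥ_ : ∀ {n} → Matrix n → Vector ℝ n → Vector ℝ n
(M *ᵥ x) i = sum λ j → M i j * x j

_·_ : ∀ {n} → ℝ → Vector ℝ n → Vector ℝ n
(c · x) i = c * x i

record Graph (n : ℕ) : Set₁ where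
  infix 4 _~_ _~?_
  field
    _~_      : Rel (Fin n) 0ℓ
    _~?_     : Decidable _~_
    ~-sym    : Symmetric _~_
    ~-irrefl : Irreflexive _≡_ _~_

-- A set of edges, as a symmetric subrelation of adjacency: Edge u w says
-- that the edge {u , w} belongs to the set.
record EdgeSet {n} (G : Graph n) : Set₁ where
  open Graph G
  field
    Edge     : Rel (Fin n) 0ℓ
    edge?    : Decidable Edge
    edge-sym : Symmetric Edge
    edge⇒~   : Edge ⇒ _~_

edgesAt : ∀ {n} (G : Graph n) → Fin n → EdgeSet G
edgesAt G v = record
  { Edge     = λ u w → u ~ w × (u ≡ v ⊎ w ≡ v)
  ; edge?    = λ u w → (u ~? w) ×-dec ((u Fin.≟ v) ⊎-dec (w Fin.≟ v))
  ; edge-sym = λ (u~w , at-v) → ~-sym u~w , swap at-v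
  ; edge⇒~   = proj₁
  }
  where open Graph G

infixl 6 _─_

_─_ : ∀ {n} (G : Graph n) → EdgeSet G → Graph n
G ─ F = record
  { _~_      = λ u w → u ~ w × ¬ Edge u w
  ; _~?_     = λ u w → (u ~? w) ×-dec ¬? (edge? u w)
  ; ~-sym    = λ (u~w , kept) → ~-sym u~w , λ e → kept (edge-sym e)
  ; ~-irrefl = λ u≡w (u~w , _) → ~-irrefl u≡w u~w
  }
  where
  open Graph G
  open EdgeSet F

module _ {n} (G : Graph n) where
  open Graph G

  degree : Fin n → ℕ
  degree u = Vec.count (u ~?_) (Vec.allFin n)

  A : Matrix n
  A i j = if does (i ~? j) then 1ℝ else 0ℝ

  D : Matrix n
  D i j = if does (i Fin.≟ j) then degree i ×ℝ 1ℝ else 0ℝ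

  L : Matrix n
  L i j = D i j - A i j

B : ∀ {n} → ℝ → Graph n → Matrix n
B α G i j = α * A G i j + (1ℝ - α) * L G i j

-- Since v is adjacent to every j with x_j ≠ 0, deleting the edges at v changes
-- the term A_ij x_j by [i = v] x_j and the term D_ij x_j by [i = j] x_j.  The
-- first change sums to [i = v] Σ x = 0, the second to x_i, and so
-- B(G) x = B(G − N_v) x + (1 − α) x.  Constructively, adjacency is decidable
-- and _≈_ is ¬¬-stable, so every j is adjacent to v or has x_j ≈ 0.
module Submission where

open import Defs
open import Algebra.Bundles using (CommutativeRing)
open import Data.Bool.Base using (true; false; if_then_else_)
open import Data.Fin.Base using (Fin; zero; suc)
import Data.Fin.Properties as Fin
open import Data.Nat.Base as ℕ using (ℕ)
import Data.Nat.Properties as ℕ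
open import Data.Product.Base using (∃; _×_; _,_; proj₁; proj₂)
open import Data.Rational.Base as ℚ using (ℚ; 0ℚ; 1ℚ; ½; Positive)
import Data.Rational.Properties as ℚ
open import Data.Rational.Solver using (module +-*-Solver)
open import Data.Sum.Base using (_⊎_; inj₁; inj₂; [_,_]′)
import Data.Vec.Base as Vec
open import Data.Vec.Functional using (Vector)
open import Function.Base using (id; _∘_; case_of_)
open import Function.Bundles using (_⇔_; mk⇔)
open import Level using (0ℓ)
open import Relation.Binary.Definitions using (Reflexive; Symmetric; Transitive)
open import Relation.Binary.PropositionalEquality as ≡ using (_≡_; _≢_)
open import Relation.Nullary using (¬_; yes; no; does)
open import Relation.Nullary.Decidable
  using (dec-true; dec-false; decidable-stable; does-⇔)
open import Relation.Nullary.Negation using (¬¬-map)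
open import Relation.Unary using (Pred; Decidable)

open +-*-Solver using (solve; con; _:=_; _:+_; _:*_; _:-_; :-_)

-- Equality of Cauchy reals and its congruences

½*-positive : ∀ ε → .{{Positive ε}} → Positive (½ ℚ.* ε)
½*-positive ε = ℚ.pos*pos⇒pos ½ ε

∣p+q∣≤ε : ∀ {ε} p q → ℚ.∣ p ∣ ℚ.≤ ½ ℚ.* ε → ℚ.∣ q ∣ ℚ.≤ ½ ℚ.* ε →
  ℚ.∣ p ℚ.+ q ∣ ℚ.≤ ε
∣p+q∣≤ε {ε} p q p≤ q≤ = begin
  ℚ.∣ p ℚ.+ q ∣              ≤⟨ ℚ.∣p+q∣≤∣p∣+∣q∣ p q ⟩
  ℚ.∣ p ∣ ℚ.+ ℚ.∣ q ∣        ≤⟨ ℚ.+-mono-≤ p≤ q≤ ⟩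
  ½ ℚ.* ε ℚ.+ ½ ℚ.* ε        ≡⟨ ℚ.*-distribʳ-+ ε ½ ½ ⟨
  1ℚ ℚ.* ε                   ≡⟨ ℚ.*-identityˡ ε ⟩
  ε                          ∎
  where open ℚ.≤-Reasoning

-- Equality ignores the moduli of convergence. As the operations act term by term, any ring identity
-- of ℚ therefore carries over to the reals.
pointwise⇒≈ : ∀ {x y} → (∀ k → seq x k ≡ seq y k) → x ≈ y
pointwise⇒≈ {x} {y} x≡y ε = 0 , λ k _ → begin
  ℚ.∣ seq x k ℚ.- seq y k ∣   ≡⟨ ≡.cong (λ p → ℚ.∣ p ℚ.- seq y k ∣) (x≡y k) ⟩
  ℚ.∣ seq y k ℚ.- seq y k ∣   ≡⟨ ≡.cong ℚ.∣_∣ (ℚ.+-inverseʳ (seq y k)) ⟩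
  0ℚ                          ≤⟨ ℚ.<⇒≤ (ℚ.positive⁻¹ ε) ⟩
  ε                           ∎
  where open ℚ.≤-Reasoning

≈-refl : Reflexive _≈_
≈-refl {x} = pointwise⇒≈ {x} {x} λ _ → ≡.refl

≈-sym : Symmetric _≈_
≈-sym {x} {y} x≈y ε = proj₁ (x≈y ε) , λ k N≤k →
  ≡.subst (ℚ._≤ ε)
    (≡.trans (≡.sym (ℚ.∣-p∣≡∣p∣ (seq x k ℚ.- seq y k)))
             (≡.cong ℚ.∣_∣ (-[p-q]≡q-p (seq x k) (seq y k))))
    (proj₂ (x≈y ε) k N≤k)
  where
  -[p-q]≡q-p : ∀ p q → ℚ.- (p ℚ.- q) ≡ q ℚ.- p
  -[p-q]≡q-p = solve 2 (λ p q → :- (p :- q) := q :- p) ≡.refl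

≈-trans : Transitive _≈_
≈-trans {x} {y} {z} x≈y y≈z ε
  with M , x-y≤ ← x≈y (½ ℚ.* ε) {{½*-positive ε}}
     | N , y-z≤ ← y≈z (½ ℚ.* ε) {{½*-positive ε}} =
  M ℕ.⊔ N , λ k M⊔N≤k → ≡.subst (λ d → ℚ.∣ d ∣ ℚ.≤ ε)
    (telescope (seq x k) (seq y k) (seq z k))
    (∣p+q∣≤ε (seq x k ℚ.- seq y k) (seq y k ℚ.- seq z k)
      (x-y≤ k (ℕ.m⊔n≤o⇒m≤o M N M⊔N≤k)) (y-z≤ k (ℕ.m⊔n≤o⇒n≤o M N M⊔N≤k)))
  where
  telescope : ∀ p q r → (p ℚ.- q) ℚ.+ (q ℚ.- r) ≡ p ℚ.- r
  telescope = solve 3 (λ p q r → (p :- q) :+ (q :- r) := p :- r) ≡.refl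

-- The index `N` comes from the modulus of `x - y` alone, before any use of `x ≈ y`. For a fixed `k`
-- beyond `N` only a decidable rational inequality remains, and that may be proved under a double
-- negation.
≈-stable : ∀ {x y} → ¬ ¬ (x ≈ y) → x ≈ y
≈-stable {x} {y} ¬¬x≈y ε
  with N , d-d≤ ← cauchy (x - y) (½ ℚ.* ε) {{½*-positive ε}} =
  N , λ k N≤k → decidable-stable (ℚ.∣ d k ∣ ℚ.≤? ε)
    (¬¬-map (∣dₖ∣≤ε N d-d≤ k N≤k) ¬¬x≈y)
  where
  d : ℕ → ℚ
  d = seq (x - y)
  [p-q]+q≡p : ∀ p q → (p ℚ.- q) ℚ.+ q ≡ p
  [p-q]+q≡p = solve 2 (λ p q → (p :- q) :+ q := p) ≡.refl
  ∣dₖ∣≤ε : ∀ N → (∀ m n → N ℕ.≤ m → N ℕ.≤ n → ℚ.∣ d m ℚ.- d n ∣ ℚ.≤ ½ ℚ.* ε) →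
    ∀ k → N ℕ.≤ k → x ≈ y → ℚ.∣ d k ∣ ℚ.≤ ε
  -- At the index `M ⊔ N` the difference is already within ε/2 of zero, and the Cauchy bound carries
  -- this back to `k` at the cost of another ε/2.
  ∣dₖ∣≤ε N d-d≤ k N≤k x≈y with M , d≤ ← x≈y (½ ℚ.* ε) {{½*-positive ε}} =
    ≡.subst (λ p → ℚ.∣ p ∣ ℚ.≤ ε) ([p-q]+q≡p (d k) (d (M ℕ.⊔ N)))
      (∣p+q∣≤ε (d k ℚ.- d (M ℕ.⊔ N)) (d (M ℕ.⊔ N))
        (d-d≤ k (M ℕ.⊔ N) N≤k (ℕ.m≤n⊔m M N)) (d≤ (M ℕ.⊔ N) (ℕ.m≤m⊔n M N)))

+-cong : ∀ {x x′ y y′} → x ≈ x′ → y ≈ y′ → x + y ≈ x′ + y′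
+-cong {x} {x′} {y} {y′} x≈x′ y≈y′ ε
  with M , x-x′≤ ← x≈x′ (½ ℚ.* ε) {{½*-positive ε}}
     | N , y-y′≤ ← y≈y′ (½ ℚ.* ε) {{½*-positive ε}} =
  M ℕ.⊔ N , λ k M⊔N≤k → ≡.subst (λ d → ℚ.∣ d ∣ ℚ.≤ ε)
    (interchange (seq x k) (seq x′ k) (seq y k) (seq y′ k))
    (∣p+q∣≤ε (seq x k ℚ.- seq x′ k) (seq y k ℚ.- seq y′ k)
      (x-x′≤ k (ℕ.m⊔n≤o⇒m≤o M N M⊔N≤k)) (y-y′≤ k (ℕ.m⊔n≤o⇒n≤o M N M⊔N≤k)))
  where
  interchange : ∀ p p′ q q′ → (p ℚ.- p′) ℚ.+ (q ℚ.- q′) ≡ (p ℚ.+ q) ℚ.- (p′ ℚ.+ q′)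
  interchange = solve 4 (λ p p′ q q′ →
    (p :- p′) :+ (q :- q′) := (p :+ q) :- (p′ :+ q′)) ≡.refl

invertScale : ∀ K ε → Positive K → Positive ε → ∃ λ δ → Positive δ × K ℚ.* δ ≡ ε
invertScale K ε K>0 ε>0 = ℚ.1/ K ℚ.* ε , ℚ.pos*pos⇒pos (ℚ.1/ K) ε , (begin
  K ℚ.* (ℚ.1/ K ℚ.* ε)    ≡⟨ ℚ.*-assoc K (ℚ.1/ K) ε ⟨
  (K ℚ.* ℚ.1/ K) ℚ.* ε    ≡⟨ ≡.cong (ℚ._* ε) (ℚ.*-inverseʳ K) ⟩
  1ℚ ℚ.* ε                ≡⟨ ℚ.*-identityˡ ε ⟩
  ε                       ∎)
  where
  open ≡.≡-Reasoning
  instance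
    _ = K>0
    _ = ε>0
    _ = ℚ.pos⇒nonZero K
    _ = ℚ.1/pos⇒pos K

∣r*p-r*q∣≤K*δ : ∀ {K δ} → Positive K → ∀ r p q →
  ℚ.∣ r ∣ ℚ.≤ K → ℚ.∣ p ℚ.- q ∣ ℚ.≤ δ → ℚ.∣ r ℚ.* p ℚ.- r ℚ.* q ∣ ℚ.≤ K ℚ.* δ
∣r*p-r*q∣≤K*δ {K} {δ} K>0 r p q r≤K p-q≤δ = begin
  ℚ.∣ r ℚ.* p ℚ.- r ℚ.* q ∣
    ≡⟨ ≡.cong ℚ.∣_∣ (factor r p q) ⟩
  ℚ.∣ r ℚ.* (p ℚ.- q) ∣
    ≡⟨ ℚ.∣p*q∣≡∣p∣*∣q∣ r (p ℚ.- q) ⟩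
  ℚ.∣ r ∣ ℚ.* ℚ.∣ p ℚ.- q ∣
    ≤⟨ ℚ.*-monoʳ-≤-nonNeg ℚ.∣ p ℚ.- q ∣ {{ℚ.∣-∣-nonNeg (p ℚ.- q)}} r≤K ⟩
  K ℚ.* ℚ.∣ p ℚ.- q ∣
    ≤⟨ ℚ.*-monoˡ-≤-nonNeg K {{ℚ.pos⇒nonNeg K {{K>0}}}} p-q≤δ ⟩
  K ℚ.* δ ∎
  where
  open ℚ.≤-Reasoning
  factor : ∀ r p q → r ℚ.* p ℚ.- r ℚ.* q ≡ r ℚ.* (p ℚ.- q)
  factor = solve 3 (λ r p q → r :* p :- r :* q := r :* (p :- q)) ≡.refl

-- The fixed factor is eventually bounded by some `K`, so closeness δ = ε/K of the other factors
-- suffices.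
*-congˡ : ∀ {c x y} → x ≈ y → c * x ≈ c * y
*-congˡ {c} {x} {y} x≈y ε =
  let K , K>0 , M , c≤K = eventuallyBounded {seq c} (cauchy c)
      δ , δ>0 , Kδ≡ε    = invertScale K ε K>0 (ℚ.positive (ℚ.positive⁻¹ ε))
      N , x-y≤δ         = x≈y δ {{δ>0}}
  in M ℕ.⊔ N , λ k M⊔N≤k → ≡.subst (ℚ.∣ seq c k ℚ.* seq x k ℚ.- seq c k ℚ.* seq y k ∣ ℚ.≤_)
    Kδ≡ε
    (∣r*p-r*q∣≤K*δ K>0 (seq c k) (seq x k) (seq y k)
      (c≤K k (ℕ.m⊔n≤o⇒m≤o M N M⊔N≤k)) (x-y≤δ k (ℕ.m⊔n≤o⇒n≤o M N M⊔N≤k)))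

*-comm : ∀ x y → x * y ≈ y * x
*-comm x y = pointwise⇒≈ {x * y} {y * x} λ k → ℚ.*-comm (seq x k) (seq y k)

-- Commutativity lets the one-sided congruence replace each factor in turn, so no second estimate is
-- made.
*-cong : ∀ {x x′ y y′} → x ≈ x′ → y ≈ y′ → x * y ≈ x′ * y′
*-cong {x} {x′} {y} {y′} x≈x′ y≈y′ =
  ≈-trans {x * y} {x * y′} {x′ * y′} (*-congˡ {x} {y} {y′} y≈y′)
    (≈-trans {x * y′} {y′ * x} {x′ * y′} (*-comm x y′)
      (≈-trans {y′ * x} {y′ * x′} {x′ * y′} (*-congˡ {y′} {x} {x′} x≈x′)
        (*-comm y′ x′)))

-‿cong : ∀ {x y} → x ≈ y → - x ≈ - y
-‿cong {x} {y} x≈y =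
  -- Negation is multiplication by the constant -1, which reduces the claim to `*-congˡ`.
  ≈-trans { - x} {fromℚ (ℚ.- 1ℚ) * x} { - y} (-≈-1* x)
    (≈-trans {fromℚ (ℚ.- 1ℚ) * x} {fromℚ (ℚ.- 1ℚ) * y} { - y}
      (*-congˡ {fromℚ (ℚ.- 1ℚ)} {x} {y} x≈y)
      (≈-sym { - y} {fromℚ (ℚ.- 1ℚ) * y} (-≈-1* y)))
  where
  -≈-1* : ∀ z → - z ≈ fromℚ (ℚ.- 1ℚ) * z
  -≈-1* z = pointwise⇒≈ { - z} {fromℚ (ℚ.- 1ℚ) * z} λ k → -p≡-1*p (seq z k)
    where
    -p≡-1*p : ∀ p → ℚ.- p ≡ (ℚ.- 1ℚ) ℚ.* p
    -p≡-1*p = solve 1 (λ p → :- p := con (ℚ.- 1ℚ) :* p) ≡.refl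

-- _≈_ unfolds to a Π-type from which x and y cannot be inferred; the record
-- makes them inferable.
infix 4 _≃_

record _≃_ (x y : ℝ) : Set where
  constructor wrap
  field unwrap : x ≈ y

open _≃_

-- The commutative ring of real numbers

pointwise⇒≃ : ∀ {x y} → (∀ k → seq x k ≡ seq y k) → x ≃ y
pointwise⇒≃ {x} {y} x≡y = wrap (pointwise⇒≈ {x} {y} x≡y)

ℝ-commutativeRing : CommutativeRing 0ℓ 0ℓ
ℝ-commutativeRing = record
  { Carrier = ℝ ; _≈_ = _≃_ ; _+_ = _+_ ; _*_ = _*_ ; -_ = -_ ; 0# = 0ℝ ; 1# = 1ℝ
  ; isCommutativeRing = record
    { isRing = record
      { +-isAbelianGroup = record
        { isGroup = record
          { isMonoid = record
            { isSemigroup = record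
              { isMagma = record
                { isEquivalence = record
                  { refl  = λ {x} → wrap (≈-refl {x})
                  ; sym   = λ {x} {y} (wrap p) → wrap (≈-sym {x} {y} p)
                  ; trans = λ {x} {y} {z} (wrap p) (wrap q) →
                      wrap (≈-trans {x} {y} {z} p q)
                  }
                ; ∙-cong = λ {x} {x′} {y} {y′} (wrap p) (wrap q) →
                    wrap (+-cong {x} {x′} {y} {y′} p q)
                }
              ; assoc = λ x y z → pointwise⇒≃ λ k → ℚ.+-assoc (seq x k) (seq y k) (seq z k)
              }
            ; identity = (λ x → pointwise⇒≃ λ k → ℚ.+-identityˡ (seq x k)) ,
                         (λ x → pointwise⇒≃ λ k → ℚ.+-identityʳ (seq x k))
            }
          ; inverse = (λ x → pointwise⇒≃ λ k → ℚ.+-inverseˡ (seq x k)) ,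
                      (λ x → pointwise⇒≃ λ k → ℚ.+-inverseʳ (seq x k))
          ; ⁻¹-cong = λ {x} {y} (wrap p) → wrap (-‿cong {x} {y} p)
          }
        ; comm = λ x y → pointwise⇒≃ λ k → ℚ.+-comm (seq x k) (seq y k)
        }
      ; *-cong = λ {x} {x′} {y} {y′} (wrap p) (wrap q) → wrap (*-cong {x} {x′} {y} {y′} p q)
      ; *-assoc = λ x y z → pointwise⇒≃ λ k → ℚ.*-assoc (seq x k) (seq y k) (seq z k)
      ; *-identity = (λ x → pointwise⇒≃ λ k → ℚ.*-identityˡ (seq x k)) ,
                     (λ x → pointwise⇒≃ λ k → ℚ.*-identityʳ (seq x k))
      ; distrib =
          (λ x y z → pointwise⇒≃ λ k → ℚ.*-distribˡ-+ (seq x k) (seq y k) (seq z k)) ,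
          (λ x y z → pointwise⇒≃ λ k → ℚ.*-distribʳ-+ (seq x k) (seq y k) (seq z k))
      }
    ; *-comm = λ x y → wrap (*-comm x y)
    }
  }

module ℝ-Ring = CommutativeRing ℝ-commutativeRing

open import Algebra.Properties.Semiring.Sum ℝ-Ring.semiring
  using (sum-cong-≋; sum-replicate-zero; ∑-distrib-+; *-distribˡ-sum)
open import Relation.Binary.Reasoning.Setoid ℝ-Ring.setoid

-- The identity matrix, whose entries also serve as indicators

I : ∀ {n} → Matrix n
I i j = if does (i Fin.≟ j) then 1ℝ else 0ℝ

I-diagonal : ∀ {n} (i : Fin n) → I i i ≡ 1ℝ
I-diagonal i = ≡.cong (if_then 1ℝ else 0ℝ) (dec-true (i Fin.≟ i) ≡.refl)

I-offDiagonal : ∀ {n} {i j : Fin n} → i ≢ j → I i j ≡ 0ℝ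
I-offDiagonal {i = i} {j} i≢j = ≡.cong (if_then 1ℝ else 0ℝ) (dec-false (i Fin.≟ j) i≢j)

I*ᵥ : ∀ {n} (x : Vector ℝ n) → ∀ i → (I *ᵥ x) i ≃ x i
I*ᵥ {ℕ.suc n} x zero = begin
  1ℝ * x zero + sum (λ j → 0ℝ * x (suc j))
    ≈⟨ ℝ-Ring.+-cong (ℝ-Ring.*-identityˡ (x zero)) (sum-cong-≋ λ j → ℝ-Ring.zeroˡ (x (suc j))) ⟩
  x zero + sum {n} (λ _ → 0ℝ)
    ≈⟨ ℝ-Ring.+-congˡ {x zero} (sum-replicate-zero n) ⟩
  x zero + 0ℝ
    ≈⟨ ℝ-Ring.+-identityʳ (x zero) ⟩
  x zero ∎
I*ᵥ {ℕ.suc n} x (suc i) = begin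
  -- The test `suc i ≟ suc j` computes to the result of `i ≟ j`, so the tail of row `suc i` is row
  -- `i` of the smaller identity matrix.
  0ℝ * x zero + (I *ᵥ (x ∘ suc)) i
    ≈⟨ ℝ-Ring.+-cong (ℝ-Ring.zeroˡ (x zero)) (I*ᵥ (x ∘ suc) i) ⟩
  0ℝ + x (suc i)
    ≈⟨ ℝ-Ring.+-identityˡ (x (suc i)) ⟩
  x (suc i) ∎

-- Counts of predicates that differ at one point

module _ {a p q} {X : Set a} {P : Pred X p} {Q : Pred X q}
  (P? : Decidable P) (Q? : Decidable Q) where

  count-tabulate-cong : ∀ {n} (f : Fin n → X) →
    (∀ j → does (P? (f j)) ≡ does (Q? (f j))) →
    Vec.count P? (Vec.tabulate f) ≡ Vec.count Q? (Vec.tabulate f)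
  count-tabulate-cong {ℕ.zero}  f P≡Q = ≡.refl
  count-tabulate-cong {ℕ.suc n} f P≡Q = ≡.cong₂ (λ b → if b then ℕ.suc else id)
    (P≡Q zero) (count-tabulate-cong (f ∘ suc) (P≡Q ∘ suc))

  -- This is the counting behind the loss of one neighbour. The recursion walks to position `v`;
  -- there `P` contributes one and `Q` nothing, and beyond it the tails agree.
  count-tabulate-suc : ∀ {n} (f : Fin n → X) v → P (f v) → ¬ Q (f v) →
    (∀ j → j ≢ v → does (P? (f j)) ≡ does (Q? (f j))) →
    Vec.count P? (Vec.tabulate f) ≡ ℕ.suc (Vec.count Q? (Vec.tabulate f))
  count-tabulate-suc f zero Pv ¬Qv P≡Q
    rewrite dec-true (P? (f zero)) Pv | dec-false (Q? (f zero)) ¬Qv =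
    ≡.cong ℕ.suc (count-tabulate-cong (f ∘ suc) λ j → P≡Q (suc j) λ ())
  count-tabulate-suc f (suc v) Pv ¬Qv P≡Q
    with IH ← count-tabulate-suc (f ∘ suc) v Pv ¬Qv
                (λ j j≢v → P≡Q (suc j) (j≢v ∘ Fin.suc-injective))
    rewrite P≡Q zero (λ ())
    -- After the rewrite both counts branch on this same test, so the head adds equally to each.
    with does (Q? (f zero))
  ... | true  = ≡.cong ℕ.suc IH
  ... | false = IH

-- Matrix entries and the algebra of a single summand

module _ {n} (G : Graph n) where
  open Graph G

  A-adjacent : ∀ {i j} → i ~ j → A G i j ≡ 1ℝ
  A-adjacent {i} {j} i~j = ≡.cong (if_then 1ℝ else 0ℝ) (dec-true (i ~? j) i~j)

  A-nonadjacent : ∀ {i j} → ¬ i ~ j → A G i j ≡ 0ℝ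
  A-nonadjacent {i} {j} i≁j = ≡.cong (if_then 1ℝ else 0ℝ) (dec-false (i ~? j) i≁j)

  D-diagonal : ∀ i → D G i i ≡ degree G i ×ℝ 1ℝ
  D-diagonal i =
    ≡.cong (if_then degree G i ×ℝ 1ℝ else 0ℝ) (dec-true (i Fin.≟ i) ≡.refl)

  D-offDiagonal : ∀ {i j} → i ≢ j → D G i j ≡ 0ℝ
  D-offDiagonal {i} {j} i≢j =
    ≡.cong (if_then degree G i ×ℝ 1ℝ else 0ℝ) (dec-false (i Fin.≟ j) i≢j)

-- For a coordinate where the vector vanishes, the matrix entry multiplying it may be exchanged for
-- any other.
*-vanish : ∀ {a b y} → y ≃ 0ℝ → a * y ≃ b * y
*-vanish {a} {b} {y} y≃0 = begin
  a * y    ≈⟨ ℝ-Ring.*-congˡ {a} y≃0 ⟩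
  a * 0ℝ   ≈⟨ ℝ-Ring.zeroʳ a ⟩
  0ℝ       ≈⟨ ℝ-Ring.zeroʳ b ⟨
  b * 0ℝ   ≈⟨ ℝ-Ring.*-congˡ {b} y≃0 ⟨
  b * y    ∎

-- With β = 1 - α the left side is a summand of B(G)x. The right side isolates the products `a * y`
-- and `d * y`, because the entries of A and D can be replaced only once multiplied by the
-- coordinate `y`.
collect : ∀ α β a d y → (α * a + β * (d - a)) * y ≃ (α - β) * (a * y) + β * (d * y)
collect α β a d y = pointwise⇒≃ λ k →
  collect-ℚ (seq α k) (seq β k) (seq a k) (seq d k) (seq y k)
  where
  collect-ℚ : ∀ α β a d y → (α ℚ.* a ℚ.+ β ℚ.* (d ℚ.- a)) ℚ.* y ≡
    (α ℚ.- β) ℚ.* (a ℚ.* y) ℚ.+ β ℚ.* (d ℚ.* y)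
  collect-ℚ = solve 5 (λ α β a d y →
    (α :* a :+ β :* (d :- a)) :* y := (α :- β) :* (a :* y) :+ β :* (d :* y)) ≡.refl

-- The return trip from `collect`: the summand of the smaller graph is restored, and the corrections
-- `e` to the adjacency entry and `f` to the degree entry are split off.
distribute : ∀ α β a d e f y →
  (α - β) * ((a + e) * y) + β * ((d + f) * y) ≃
  (α * a + β * (d - a)) * y + ((α - β) * e * y + β * (f * y))
distribute α β a d e f y = pointwise⇒≃ λ k →
  distribute-ℚ (seq α k) (seq β k) (seq a k) (seq d k) (seq e k) (seq f k) (seq y k)
  where
  distribute-ℚ : ∀ α β a d e f y →
    (α ℚ.- β) ℚ.* ((a ℚ.+ e) ℚ.* y) ℚ.+ β ℚ.* ((d ℚ.+ f) ℚ.* y) ≡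
    (α ℚ.* a ℚ.+ β ℚ.* (d ℚ.- a)) ℚ.* y ℚ.+
    ((α ℚ.- β) ℚ.* e ℚ.* y ℚ.+ β ℚ.* (f ℚ.* y))
  distribute-ℚ = solve 7 (λ α β a d e f y →
    (α :- β) :* ((a :+ e) :* y) :+ β :* ((d :+ f) :* y) :=
    (α :* a :+ β :* (d :- a)) :* y :+ ((α :- β) :* e :* y :+ β :* (f :* y))) ≡.refl

-- Deleting the edges at a vertex

module _ {n} (G : Graph n) (v : Fin n) where
  open Graph G

  private
    G′ : Graph n
    G′ = G ─ edgesAt G v
    open Graph G′ using () renaming (_~_ to _~′_; _~?_ to _~′?_)

  does-away : ∀ {i j} → i ≢ v → j ≢ v → does (i ~? j) ≡ does (i ~′? j)
  does-away {i} {j} i≢v j≢v = does-⇔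
    (mk⇔ (λ i~j → i~j , [ i≢v , j≢v ]′ ∘ proj₂) proj₁) (i ~? j) (i ~′? j)

  neighbour≢ : ∀ {u} → v ~ u → u ≢ v
  neighbour≢ v~u u≡v = ~-irrefl (≡.sym u≡v) v~u

  -- Without loops `i` differs from `v`, so the only edge at `i` that is deleted is the one joining
  -- it to `v`.
  degree-delete : ∀ {i} → v ~ i → degree G i ≡ ℕ.suc (degree G′ i)
  degree-delete {i} v~i = count-tabulate-suc (i ~?_) (i ~′?_) id v (~-sym v~i)
    (λ (i~v , kept) → kept (i~v , inj₂ ≡.refl)) (λ j → does-away (neighbour≢ v~i))

  -- As `j` is not `v`, an edge between `i` and `j` can meet `v` only if `i` is `v`; in that row the
  -- entry drops from 1 to 0.
  A-delete : ∀ i {j} → v ~ j → A G i j ≃ A G′ i j + I i v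
  A-delete i {j} v~j = case i Fin.≟ v of λ where
    (no i≢v) → begin
      A G i j              ≡⟨ ≡.cong (if_then 1ℝ else 0ℝ) (does-away i≢v (neighbour≢ v~j)) ⟩
      A G′ i j             ≈⟨ ℝ-Ring.+-identityʳ (A G′ i j) ⟨
      A G′ i j + 0ℝ        ≡⟨ ≡.cong (A G′ i j +_) (I-offDiagonal i≢v) ⟨
      A G′ i j + I i v     ∎
    (yes ≡.refl) → begin
      A G v j              ≡⟨ A-adjacent G v~j ⟩
      1ℝ                   ≈⟨ ℝ-Ring.+-identityˡ 1ℝ ⟨
      0ℝ + 1ℝ              ≡⟨ ≡.cong₂ _+_
                                (A-nonadjacent G′ λ (e , kept) → kept (e , inj₁ ≡.refl))
                                (I-diagonal v) ⟨
      A G′ v j + I v v     ∎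

  D-delete : ∀ i {j} → v ~ j → D G i j ≃ D G′ i j + I i j
  D-delete i {j} v~j = case i Fin.≟ j of λ where
    (no i≢j) → begin
      D G i j                   ≡⟨ D-offDiagonal G i≢j ⟩
      0ℝ                        ≈⟨ ℝ-Ring.+-identityʳ 0ℝ ⟨
      0ℝ + 0ℝ                   ≡⟨ ≡.cong₂ _+_ (D-offDiagonal G′ i≢j) (I-offDiagonal i≢j) ⟨
      D G′ i j + I i j          ∎
    (yes ≡.refl) → begin
      D G i i                   ≡⟨ D-diagonal G i ⟩
      degree G i ×ℝ 1ℝ          ≡⟨ ≡.cong (_×ℝ 1ℝ) (degree-delete v~j) ⟩
      -- A multiple by a successor unfolds with the new 1 in front, hence the commutation.
      1ℝ + degree G′ i ×ℝ 1ℝ    ≈⟨ ℝ-Ring.+-comm 1ℝ (degree G′ i ×ℝ 1ℝ) ⟩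
      degree G′ i ×ℝ 1ℝ + 1ℝ    ≡⟨ ≡.cong₂ _+_ (D-diagonal G′ i) (I-diagonal i) ⟨
      D G′ i i + I i i          ∎

  module _ (x : Vector ℝ n) (adj : ∀ u → ¬ (x u ≈ 0ℝ) → v ~ u) where

    zero-or-neighbour : ∀ u → x u ≃ 0ℝ ⊎ v ~ u
    zero-or-neighbour u with v ~? u
    ... | yes v~u = inj₂ v~u
    -- The contrapositive of `adj` gives only a double negation, which stability removes.
    ... | no  v≁u = inj₁ (wrap (≈-stable {x u} {0ℝ} (v≁u ∘ adj u)))

    A-term : ∀ i j → A G i j * x j ≃ (A G′ i j + I i v) * x j
    A-term i j with zero-or-neighbour j
    ... | inj₁ xⱼ≃0 = *-vanish {A G i j} {A G′ i j + I i v} xⱼ≃0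
    ... | inj₂ v~j  = ℝ-Ring.*-congʳ {x j} (A-delete i v~j)

    D-term : ∀ i j → D G i j * x j ≃ (D G′ i j + I i j) * x j
    D-term i j with zero-or-neighbour j
    ... | inj₁ xⱼ≃0 = *-vanish {D G i j} {D G′ i j + I i j} xⱼ≃0
    ... | inj₂ v~j  = ℝ-Ring.*-congʳ {x j} (D-delete i v~j)

    -- The first correction is grouped so that its coefficient of `x j` does not depend on `j`; the
    -- second is a summand of the identity matrix applied to `x`. Both can then be summed in closed
    -- form.
    B-term : ∀ α i j → B α G i j * x j ≃
      B α G′ i j * x j + ((α - (1ℝ - α)) * I i v * x j + (1ℝ - α) * (I i j * x j))
    B-term α i j = begin
      (α * a + β * (d - a)) * y
        ≈⟨ collect α β a d y ⟩
      (α - β) * (a * y) + β * (d * y)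
        ≈⟨ ℝ-Ring.+-cong (ℝ-Ring.*-congˡ {α - β} (A-term i j)) (ℝ-Ring.*-congˡ {β} (D-term i j)) ⟩
      (α - β) * ((a′ + I i v) * y) + β * ((d′ + I i j) * y)
        ≈⟨ distribute α β a′ d′ (I i v) (I i j) y ⟩
      (α * a′ + β * (d′ - a′)) * y + ((α - β) * I i v * y + β * (I i j * y)) ∎
      where
      β = 1ℝ - α
      a = A G i j
      d = D G i j
      a′ = A G′ i j
      d′ = D G′ i j
      y = x j

    B-delete : sum x ≃ 0ℝ → ∀ α i → (B α G *ᵥ x) i ≃ (B α G′ *ᵥ x) i + (1ℝ - α) * x i
    B-delete ∑x≃0 α i = begin
      sum (λ j → B α G i j * x j)
        ≈⟨ sum-cong-≋ (B-term α i) ⟩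
      sum (λ j → B α G′ i j * x j + (c * x j + β * (I i j * x j)))
        ≈⟨ ∑-distrib-+ (λ j → B α G′ i j * x j) (λ j → c * x j + β * (I i j * x j)) ⟩
      b + sum (λ j → c * x j + β * (I i j * x j))
        ≈⟨ ℝ-Ring.+-congˡ {b} (∑-distrib-+ (λ j → c * x j) (λ j → β * (I i j * x j))) ⟩
      b + (sum (λ j → c * x j) + sum (λ j → β * (I i j * x j)))
        ≈⟨ ℝ-Ring.+-congˡ {b} (ℝ-Ring.+-cong (*-distribˡ-sum c x) (*-distribˡ-sum β (λ j → I i j * x j))) ⟨
      b + (c * sum x + β * (I *ᵥ x) i)
        -- The adjacency correction is now a multiple of the coordinate sum and vanishes; the degree
        -- correction picks out `x i`.
        ≈⟨ ℝ-Ring.+-congˡ {b} (ℝ-Ring.+-cong (ℝ-Ring.trans (ℝ-Ring.*-congˡ {c} ∑x≃0) (ℝ-Ring.zeroʳ c))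
                                             (ℝ-Ring.*-congˡ {β} (I*ᵥ x i))) ⟩
      b + (0ℝ + β * x i)
        ≈⟨ ℝ-Ring.+-congˡ {b} (ℝ-Ring.+-identityˡ (β * x i)) ⟩
      b + β * x i ∎
      where
      β = 1ℝ - α
      c = (α - β) * I i v
      b = (B α G′ *ᵥ x) i

-- The shift of the eigenvalue equation

theorem3p7 : (α : ℝ) → 0ℝ ≤ α → α ≤ 1ℝ →
    (n : ℕ) (G : Graph n) (lam : ℝ) (x : Vector ℝ n) →
    sum x ≈ 0ℝ →
    (v : Fin n) → x v ≈ 0ℝ →
    (∀ u → ¬ (x u ≈ 0ℝ) → Graph._~_ G v u) →
    (B α G *ᵥ x ≋ lam · x) ⇔ (B α (G ─ edgesAt G v) *ᵥ x ≋ (lam - 1ℝ + α) · x)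
theorem3p7 α _ _ n G lam x ∑x≈0 v _ adj = mk⇔
  -- The two products differ by `β * x i`, so each direction subtracts or adds this term and uses λ
  -- - β = λ - 1 + α.
  (λ Bx≈λx i → unwrap (begin
    B′x i                              ≈⟨ p≃[p+q]-q (B′x i) (β * x i) ⟩
    (B′x i + β * x i) - β * x i        ≈⟨ ℝ-Ring.+-congʳ (Bx≃B′x+βx i) ⟨
    Bx i - β * x i                     ≈⟨ ℝ-Ring.+-congʳ (wrap {Bx i} {lam * x i} (Bx≈λx i)) ⟩
    lam * x i - β * x i                ≈⟨ shift (x i) ⟩
    (lam - 1ℝ + α) * x i               ∎))
  (λ B′x≈μx i → unwrap (begin
    Bx i                               ≈⟨ Bx≃B′x+βx i ⟩
    B′x i + β * x i                    ≈⟨ ℝ-Ring.+-congʳ (wrap {y = (lam - 1ℝ + α) * x i} (B′x≈μx i)) ⟩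
    (lam - 1ℝ + α) * x i + β * x i     ≈⟨ unshift (x i) ⟩
    lam * x i                          ∎))
  where
  β = 1ℝ - α
  Bx  = B α G *ᵥ x
  B′x = B α (G ─ edgesAt G v) *ᵥ x
  Bx≃B′x+βx = B-delete G v x adj (wrap ∑x≈0) α
  p≃[p+q]-q : ∀ p q → p ≃ (p + q) - q
  p≃[p+q]-q p q = pointwise⇒≃ λ k → identity (seq p k) (seq q k)
    where
    identity : ∀ p q → p ≡ (p ℚ.+ q) ℚ.- q
    identity = solve 2 (λ p q → p := (p :+ q) :- q) ≡.refl
  shift : ∀ y → lam * y - β * y ≃ (lam - 1ℝ + α) * y
  shift y = pointwise⇒≃ λ k → identity (seq lam k) (seq α k) (seq y k)
    where
    identity : ∀ l a y → l ℚ.* y ℚ.- (1ℚ ℚ.- a) ℚ.* y ≡ (l ℚ.- 1ℚ ℚ.+ a) ℚ.* y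
    identity = solve 3 (λ l a y →
      l :* y :- (con 1ℚ :- a) :* y := (l :- con 1ℚ :+ a) :* y) ≡.refl
  unshift : ∀ y → (lam - 1ℝ + α) * y + β * y ≃ lam * y
  unshift y = pointwise⇒≃ λ k → identity (seq lam k) (seq α k) (seq y k)
    where
    identity : ∀ l a y → (l ℚ.- 1ℚ ℚ.+ a) ℚ.* y ℚ.+ (1ℚ ℚ.- a) ℚ.* y ≡ l ℚ.* y
    identity = solve 3 (λ l a y →
      (l :- con 1ℚ :+ a) :* y :+ (con 1ℚ :- a) :* y := l :* y) ≡.refl
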